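{- Let $m$ be a natural number. Then $\mathcal{C}_m$ is a regular subset of $\Sigma_m^*$.
   Context: An $m\times n$ diagram is an $m\times n$ grid of squares in which each square is colored black or white. An $m\times n$ diagram is a Cauchon diagram if whenever a square is colored black, either every square in the same row to its left is also black or every square in the same column above it is also black. For $S\subseteq\{1,\dots,m\}$, $C(S)$ denotes the $m\times 1$ diagram (column) whose white squares are precisely in the rows indexed by $S$, and $\Sigma_m=\{C(S) : S\subseteq\{1,\dots,m\}\}$. The set of all diagrams with exactly $m$ rows (and any number $n\ge 0$ of columns), under horizontal concatenation (placing the second diagram immediately to the right of the first), with the empty diagram as identity, is identified with the free monoid $\Sigma_m^*$ of finite words on the finite alphabet $\Sigma_m$. $\mathcal{C}_m\subseteq\Sigma_m^*$ is the set of Cauchon diagrams with exactly $m$ rows. A subset of $\Sigma^*$ ($\Sigma$ a finite alphabet) is regular if it is the set of words accepted by some (deterministic) finite state automaton $(Q,\Sigma,\delta,q_0,F)$ with finite state set $Q$, transition function $\delta:Q\times\Sigma\to Q$, initial state $q_0$, and set of accepting states $F\subseteq Q$; a word $w$ is accepted if $\delta(q_0,w)\in F$, where $\delta$ is extended to words by $\delta(q,\varepsilon)=q$ for the empty word $\varepsilon$ and $\delta(q,wx)=\delta(\delta(q,w),x)$. -}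

module Defs where

open import Data.Bool.Base using (Bool; true; if_then_else_)
open import Data.Fin.Base using (Fin; _<_)
open import Data.Fin.Subset using (Subset)
open import Data.List.Base using (List; []; _∷_; length; foldl)
open import Data.Nat.Base using (ℕ; _+_)
open import Data.Product.Base using (∃-syntax)
open import Data.Sum.Base using (_⊎_)
import Data.Vec.Base as Vec
open import Data.Vec.Functional as Vector using (Vector)
open import Function.Bundles using (_↔_)
open import Level using (0ℓ)
open import Relation.Binary.PropositionalEquality using (_≡_)
open import Relation.Unary using (Pred; _≐_)

data Colour : Set where
  black white : Colour

-- Rows are numbered from top to bottom, columns from left to right.
Diagram : ℕ → ℕ → Set
Diagram m n = Vector (Vector Colour n) m

IsCauchon : ∀ {m n} → Diagram m n → Set
IsCauchon D = ∀ i j → D i j ≡ black →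
  (∀ j′ → j′ < j → D i j′ ≡ black) ⊎ (∀ i′ → i′ < i → D i′ j ≡ black)

emptyDiagram : ∀ {m} → Diagram m 0
emptyDiagram i = Vector.[]

infixr 5 _∥_

_∥_ : ∀ {m n p} → Diagram m n → Diagram m p → Diagram m (n + p)
(D ∥ E) i = D i Vector.++ E i

C : ∀ {m} → Subset m → Diagram m 1
C S i j = if Vec.lookup S i then white else black

-- The letter C(S) is represented by S itself: S ↦ C S is injective, and
-- Subset m (a vector of m Booleans), unlike a function type, has an
-- equality that needs no function extensionality.
Σ[_] : ℕ → Set
Σ[ m ] = Subset m

-- The identification of words over Σ[ m ] with diagrams with m rows; the
-- head of the list is the leftmost column.
diagram : ∀ {m} (w : List Σ[ m ]) → Diagram m (length w)
diagram []      = emptyDiagram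
diagram (S ∷ w) = C S ∥ diagram w

Language : Set → Set₁
Language A = Pred (List A) 0ℓ

𝒞 : ∀ m → Language Σ[ m ]
𝒞 m w = IsCauchon (diagram w)

-- Finiteness of the alphabet A plays no role in the definition; it holds
-- for Σ[ m ]. The set of accepting states is given by its characteristic
-- function, as a subset of a finite set is classically.
record DFA (A : Set) : Set₁ where
  field
    Q      : Set
    size   : ℕ
    finite : Q ↔ Fin size
    δ      : Q → A → Q
    q₀     : Q
    F      : Q → Bool

  δ* : Q → List A → Q
  δ* = foldl δ

  Accepts : Language A
  Accepts w = F (δ* q₀ w) ≡ true

Regular : ∀ {A} → Language A → Set₁
Regular {A} L = ∃[ M ] L ≐ DFA.Accepts {A} M

{-# OPTIONS --safe #-}
-- Of the columns already read, only the set W of rows containing a white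
-- square matters for the rest: a black square of row i has only black squares
-- to its left iff i ∉ W and the squares to its left among the later columns
-- are black. So the automaton remembers W, together with one bit recording
-- whether a violation has occurred.
module Submission where

open import Defs
open import Data.Bool.Base using (Bool; true; false; _∧_)
open import Data.Fin.Base using (Fin; zero; suc; _<_)
open import Data.Fin.Properties using (all?; _<?_; *↔×; 2↔Bool)
open import Data.Fin.Subset using (Subset; ⊥; _∪_; _∉_)
open import Data.Fin.Subset.Properties
  using (_∈?_; ∉⊥; x∈p∪q⁻; x∈p∪q⁺)
open import Data.List.Base using ([]; _∷_)
open import Data.Nat.Base using (ℕ; zero; suc; _*_; _^_; z<s; s<s; s<s⁻¹)
open import Data.Product.Base using (_×_; _,_; proj₁; proj₂)
open import Data.Product.Function.NonDependent.Propositional using (_×-↔_)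
open import Data.Sum.Base using (_⊎_; inj₁; inj₂; [_,_]; map₁)
open import Data.Vec.Base using ([]; _∷_; lookup; uncons)
open import Data.Vec.Properties using ([]=⇒lookup; lookup⇒[]=)
open import Function.Base using (_∘_)
open import Function.Bundles using (_↔_; mk↔ₛ′)
open import Function.Construct.Composition using (_↔-∘_)
open import Function.Construct.Symmetry using (↔-sym)
open import Relation.Binary.PropositionalEquality using (_≡_; refl; trans; sym)
open import Relation.Nullary using (Dec; yes; no; contradiction)
open import Relation.Nullary.Decidable
  using (⌊_⌋; ¬?; _×-dec_; _⊎-dec_; _→-dec_)

Subset↔Fin : ∀ n → Subset n ↔ Fin (2 ^ n)
Subset↔Fin zero    = mk↔ₛ′ (λ _ → zero) (λ _ → []) (λ { zero → refl }) (λ { [] → refl })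
Subset↔Fin (suc n) =
  ↔-sym *↔× ↔-∘ ((↔-sym 2↔Bool ×-↔ Subset↔Fin n) ↔-∘ uncons-↔)
  where
  uncons-↔ : Subset (suc n) ↔ (Bool × Subset n)
  uncons-↔ = mk↔ₛ′ uncons (λ (b , S) → b ∷ S) (λ _ → refl) (λ { (_ ∷ _) → refl })

black? : ∀ c → Dec (c ≡ black)
black? black = yes refl
black? white = no λ ()

C-black⇒∉ : ∀ {m} (S : Subset m) i → C S i zero ≡ black → i ∉ S
C-black⇒∉ S i b i∈S with lookup S i | []=⇒lookup i∈S
... | true | refl = contradiction b λ ()

∉⇒C-black : ∀ {m} (S : Subset m) i → i ∉ S → C S i zero ≡ black
∉⇒C-black S i i∉S with lookup S i in eq
... | true  = contradiction (lookup⇒[]= i S eq) i∉S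
... | false = refl

-- The condition on D when it is placed to the right of a diagram whose rows
-- containing a white square are those in W.
IsCauchonAfter : ∀ {m n} → Subset m → Diagram m n → Set
IsCauchonAfter W D = ∀ i j → D i j ≡ black →
  (i ∉ W × (∀ j′ → j′ < j → D i j′ ≡ black)) ⊎ (∀ i′ → i′ < i → D i′ j ≡ black)

isCauchonAfter? : ∀ {m n} W (D : Diagram m n) → Dec (IsCauchonAfter W D)
isCauchonAfter? W D = all? λ i → all? λ j → black? (D i j) →-dec
  ((¬? (i ∈? W) ×-dec all? λ j′ → (j′ <? j) →-dec black? (D i j′))
    ⊎-dec all? λ i′ → (i′ <? i) →-dec black? (D i′ j))

module _ {m n} {W S : Subset m} {D : Diagram m n} where

  -- Prepending `C S` adds one square to the left of each square of `D` in row `i`, and it is black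
  -- iff `i ∉ S`; joined with `i ∉ W` this is `i ∉ W ∪ S`. The squares above lie in the same column
  -- and do not change.
  after-∥⁻ : IsCauchonAfter W (C S ∥ D) →
             IsCauchonAfter W (C S) × IsCauchonAfter (W ∪ S) D
  after-∥⁻ c = first , rest
    where
    first : IsCauchonAfter W (C S)
    -- In the leftmost column, all that remains of the condition on the left is `i ∉ W`.
    first i zero b = map₁ (λ (i∉W , _) → i∉W , λ _ ()) (c i zero b)

    rest : IsCauchonAfter (W ∪ S) D
    rest i j b = map₁
      (λ (i∉W , left) →
        [ i∉W , C-black⇒∉ S i (left zero z<s) ] ∘ x∈p∪q⁻ W S ,
        λ j′ j′<j → left (suc j′) (s<s j′<j))
      (c i (suc j) b)

  after-∥⁺ : IsCauchonAfter W (C S) → IsCauchonAfter (W ∪ S) D →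
             IsCauchonAfter W (C S ∥ D)
  after-∥⁺ first rest i zero    b = map₁ (λ (i∉W , _) → i∉W , λ _ ()) (first i zero b)
  after-∥⁺ first rest i (suc j) b = map₁
    (λ (i∉W∪S , left) → i∉W∪S ∘ x∈p∪q⁺ ∘ inj₁ , λ where
      zero     _    → ∉⇒C-black S i (i∉W∪S ∘ x∈p∪q⁺ ∘ inj₂)
      (suc j′) j′<j → left j′ (s<s⁻¹ j′<j))
    (rest i j b)

cauchonDFA : ∀ m → DFA Σ[ m ]
cauchonDFA m = record
  { Q      = Bool × Subset m
  ; size   = 2 * 2 ^ m
  ; finite = ↔-sym *↔× ↔-∘ (↔-sym 2↔Bool ×-↔ Subset↔Fin m)
  -- The column is tested against the old `W`, since only columns strictly to its left count.
  -- Nothing to its right matters, so one test per column suffices.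
  ; δ      = λ (ok , W) S → ok ∧ ⌊ isCauchonAfter? W (C S) ⌋ , W ∪ S
  ; q₀     = true , ⊥
  ; F      = proj₁
  }

module _ {m : ℕ} where
  open DFA (cauchonDFA m)

  -- The bit is updated by a conjunction, and `false ∧ _` reduces to `false`.
  violation-persists : ∀ W w → F (δ* (false , W) w) ≡ false
  violation-persists W []      = refl
  violation-persists W (S ∷ w) = violation-persists (W ∪ S) w

  -- Stated for every `W`, since the induction on the word passes from `W` to `W ∪ S`.
  after⇒accepted : ∀ W w → IsCauchonAfter W (diagram w) → F (δ* (true , W) w) ≡ true
  after⇒accepted W []      c = refl
  after⇒accepted W (S ∷ w) c with isCauchonAfter? W (C S) | after-∥⁻ {D = diagram w} c
  ... | yes _     | _     , rest = after⇒accepted (W ∪ S) w rest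
  ... | no ¬first | first , _    = contradiction first ¬first

  accepted⇒after : ∀ W w → F (δ* (true , W) w) ≡ true → IsCauchonAfter W (diagram w)
  accepted⇒after W []      a i ()
  accepted⇒after W (S ∷ w) a with isCauchonAfter? W (C S)
  ... | yes first = after-∥⁺ {D = diagram w} first (accepted⇒after (W ∪ S) w a)
  ... | no _      = contradiction (trans (sym a) (violation-persists (W ∪ S) w)) λ ()

theorem6p1 : (m : ℕ) → Regular (𝒞 m)
theorem6p1 m = cauchonDFA m ,
  -- Before any column is read no row contains a white square, so `i ∉ ⊥` is supplied here and
  -- discarded in the converse.
  (λ {w} c → after⇒accepted ⊥ w λ i j → map₁ (∉⊥ ,_) ∘ c i j) ,
  (λ {w} a i j → map₁ proj₂ ∘ accepted⇒after ⊥ w a i j)
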